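{- Let $R$ be a graph on $s$ vertices having exactly $\ell$ vertices of degree one. Then \[ \operatorname{fl}(R)\le 5\cdot 2^{s-2}+(s-\ell-2)\,2^{s-\ell-1}. \]
   Context: For a finite simple graph $R$, let $\mathrm{Ind}(R)$ be the set of independent sets of $R$, and for a nonempty $I\subseteq V(R)$ let $\delta_I=\min\{d_R(x):x\in I\}$, where $d_R$ is the degree in $R$. The fixed loss of $R$ is $\operatorname{fl}(R)=\sum_{I\in\mathrm{Ind}(R),\,I\neq\emptyset}(2^{\delta_I}-1)$. -}

module Defs where

open import Data.Nat using (ℕ; zero; suc; _+_; _∸_; _^_; _⊓_)
open import Data.Bool using (Bool; true; false; if_then_else_; _∧_; not)
open import Data.Fin using (Fin)
open import Data.Fin.Subset using (Subset)
open import Data.Vec using (Vec; []; _∷_; lookup)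
open import Data.List using (List; []; _∷_; map; filter; allFin; _++_; length)
open import Data.Nat.ListAction using (sum)
open import Data.Bool.ListAction using (all; any)
open import Relation.Binary.PropositionalEquality using (_≡_)
open import Relation.Nullary.Decidable using (does)
open import Data.Bool.Properties using () renaming (_≟_ to _≟ᵇ_)

record Graph (s : ℕ) : Set where
  field
    adj    : Fin s → Fin s → Bool
    sym    : ∀ x y → adj x y ≡ adj y x
    irrefl : ∀ x → adj x x ≡ false
open Graph public

degree : ∀ {s} → Graph s → Fin s → ℕ
degree {s} R x = length (filter (λ y → adj R x y ≟ᵇ true) (allFin s))

numDegOne : ∀ {s} → Graph s → ℕ
numDegOne {s} R = length (filter (λ x → degree R x Data.Nat.≟ 1) (allFin s))

allSubsets : (n : ℕ) → List (Subset n)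
allSubsets zero    = [] ∷ []
allSubsets (suc n) = map (false ∷_) (allSubsets n) ++ map (true ∷_) (allSubsets n)

members : ∀ {n} → Subset n → List (Fin n)
members {n} I = filter (λ x → lookup I x ≟ᵇ true) (allFin n)

isIndependent : ∀ {s} → Graph s → Subset s → Bool
isIndependent R I = all (λ x → all (λ y → not (adj R x y)) (members I)) (members I)

isNonempty : ∀ {n} → Subset n → Bool
isNonempty I = any (λ _ → true) (members I)

-- minimum of a list (value on [] is irrelevant: only used on nonempty lists)
minList : List ℕ → ℕ
minList []       = 0
minList (x ∷ []) = x
minList (x ∷ y ∷ xs) = x ⊓ minList (y ∷ xs)

δ : ∀ {s} → Graph s → Subset s → ℕ
δ R I = minList (map (degree R) (members I))

fl : ∀ {s} → Graph s → ℕ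
fl {s} R = sum (map (λ I → if isIndependent R I ∧ isNonempty I then 2 ^ δ R I ∸ 1 else 0)
                    (allSubsets s))

{-# OPTIONS --safe #-}
-- Let L be the set of leaves, m = s − ℓ, and a(x) the number of leaves adjacent to x.
-- An independent set I meeting L contributes at most 1; if ℓ ≥ 1, fix an edge with one
-- end in L: such I do not contain this edge, so there are at most 3·2^(s−2) − 2^m of them.
-- An independent set I avoiding L is charged to a vertex x ∈ I of degree δ_I.
-- Then I ∖ {x} avoids L ∪ N[x], so x is charged at most
-- 2^d(x) · 2^(m − 1 − (d(x) − a(x))) = 2^(m−1) · 2^a(x) in total.
-- Finally Σ a(x) ≤ ℓ and convexity give Σ_{x ∉ L} 2^a(x) ≤ 2^ℓ + m − 1.
module Submission where

open import Defs hiding (sym)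

module Counting where

  open import Algebra.Properties.CommutativeMonoid.Sum as Sum using ()
  open import Data.Bool using (Bool; true; false; if_then_else_; _∧_; not)
  open import Data.Bool.ListAction using (all)
  open import Data.Bool.Properties using () renaming (_≟_ to _≟ᵇ_)
  open import Data.Fin using (Fin; zero; suc; _≟_)
  open import Data.Fin.Properties using (any?)
  open import Data.Fin.Subset using (Subset)
  open import Data.List using (List; []; _∷_; map; filter; tabulate; allFin; length; _++_)
  open import Data.List.Membership.Propositional using (_∈_)
  open import Data.List.Membership.Propositional.Properties using (∈-filter⁺; ∈-filter⁻; ∈-allFin)
  open import Data.List.Properties using (map-++; map-∘; map-cong)
  open import Data.List.Relation.Unary.Any using (here; there)
  open import Data.Nat renaming (_≟_ to _≟ⁿ_)
  open import Data.Nat.ListAction using () renaming (sum to sumᴸ)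
  open import Data.Nat.ListAction.Properties using (sum-++)
  open import Data.Nat.Properties hiding (_≟_)
  open import Data.Nat.Tactic.RingSolver using (solve-∀)
  open import Data.Product using (_×_; _,_; ∃; proj₂)
  open import Data.Sum using (inj₁; inj₂)
  open import Data.Vec using ([]; _∷_; lookup)
  open import Function using (_∘_)
  open import Level using (0ℓ)
  open import Relation.Binary.PropositionalEquality using (_≡_; _≢_; refl; sym; trans; cong; cong₂; subst; module ≡-Reasoning)
  open import Relation.Nullary using (Dec; yes; no; does; contradiction; _×-dec_)
  open import Relation.Unary using (Pred; Decidable)

  open import Algebra.Properties.Semiring.Sum +-*-semiring using (*-distribˡ-sum)

  module ∑ = Sum +-0-commutativeMonoid
  -- In this instance the additive lemma names speak of products: `∏.sum-replicate-zero` says that a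
  -- product of ones is 1, and `∏.∑-distrib-+` splits a product of pointwise products.
  module ∏ = Sum *-1-commutativeMonoid

  ∑ ∏ : ∀ {n} → (Fin n → ℕ) → ℕ
  ∑ = ∑.sum
  ∏ = ∏.sum

  𝟙 : Bool → ℕ
  𝟙 true  = 1
  𝟙 false = 0

  -- Sums and products over Fin n

  f≤∑f : ∀ {n} (f : Fin n → ℕ) i → f i ≤ ∑ f
  f≤∑f f zero    = m≤m+n _ _
  f≤∑f f (suc i) = ≤-trans (f≤∑f (f ∘ suc) i) (m≤n+m _ _)

  ∑-zero : ∀ {n} (f : Fin n → ℕ) → (∀ i → f i ≡ 0) → ∑ f ≡ 0
  ∑-zero {zero}  f f≡0 = refl
  ∑-zero {suc n} f f≡0 = cong₂ _+_ (f≡0 zero) (∑-zero (f ∘ suc) (f≡0 ∘ suc))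

  ∏-zero : ∀ {n} {f : Fin n → ℕ} i → f i ≡ 0 → ∏ f ≡ 0
  ∏-zero {f = f} zero    fi≡0 = cong (_* ∏ (f ∘ suc)) fi≡0
  ∏-zero {f = f} (suc i) fi≡0 = trans (cong (f zero *_) (∏-zero i fi≡0)) (*-zeroʳ (f zero))

  ∏≤1 : ∀ {n} {f : Fin n → ℕ} → (∀ i → f i ≤ 1) → ∏ f ≤ 1
  ∏≤1 {zero}  f≤1 = ≤-refl
  ∏≤1 {suc n} f≤1 = *-mono-≤ (f≤1 zero) (∏≤1 (f≤1 ∘ suc))

  ∏-2^ : ∀ {n} (f : Fin n → ℕ) → ∏ (λ i → 2 ^ f i) ≡ 2 ^ ∑ f
  ∏-2^ {zero}  f = refl
  ∏-2^ {suc n} f = trans (cong (2 ^ f zero *_) (∏-2^ (f ∘ suc)))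
                         (sym (^-distribˡ-+-* 2 (f zero) _))

  -- The right side exceeds the left by (m - 1)(n - 1).
  m+n≤1+m*n : ∀ m n → 1 ≤ m → 1 ≤ n → m + n ≤ 1 + m * n
  m+n≤1+m*n (suc m) (suc n) _ _ = ≤-trans (m≤m+n _ (m * n)) (≤-reflexive (expand m n))
    where
    expand : ∀ m n → suc m + suc n + m * n ≡ 1 + suc m * suc n
    expand = solve-∀

  -- Convexity: the extreme case puts the whole exponent on one selected index and leaves 2^0 = 1 at
  -- the others. Selected indices are merged one by one by `m+n≤1+m*n`; the exponent of an
  -- unselected index only enlarges `2 ^ ∑ a`. The `1 +` on the left stands for a `- 1` on the right
  -- and keeps the bound true when nothing is selected.
  ∑2^≤2^∑ : ∀ {n} (c : Fin n → Bool) (a : Fin n → ℕ) →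
            1 + ∑ (λ x → 𝟙 (c x) * 2 ^ a x) ≤ 2 ^ ∑ a + ∑ (𝟙 ∘ c)
  ∑2^≤2^∑ {zero}  c a = ≤-refl
  ∑2^≤2^∑ {suc n} c a with c zero | ∑2^≤2^∑ (c ∘ suc) (a ∘ suc)
  ... | false | ih = ≤-trans ih (+-monoˡ-≤ _ (^-monoʳ-≤ 2 (m≤n+m _ (a zero))))
  ... | true  | ih = begin
    1 + (1 * u + T)            ≡⟨ rearrange u T ⟩
    u + (1 + T)                ≤⟨ +-monoʳ-≤ u ih ⟩
    u + (v + C)                ≡⟨ +-assoc u v C ⟨
    u + v + C                  ≤⟨ +-monoˡ-≤ C (m+n≤1+m*n u v (m^n>0 2 (a zero)) (m^n>0 2 (∑ (a ∘ suc)))) ⟩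
    1 + u * v + C              ≡⟨ cong (λ w → 1 + w + C) (^-distribˡ-+-* 2 (a zero) _) ⟨
    1 + 2 ^ ∑ a + C            ≡⟨ +-suc (2 ^ ∑ a) C ⟨
    2 ^ ∑ a + (1 + C)          ∎
    where
    open ≤-Reasoning
    u v T C : ℕ
    u = 2 ^ a zero
    v = 2 ^ ∑ (a ∘ suc)
    T = ∑ (λ x → 𝟙 (c (suc x)) * 2 ^ a (suc x))
    C = ∑ (𝟙 ∘ c ∘ suc)
    rearrange : ∀ u T → 1 + (1 * u + T) ≡ u + (1 + T)
    rearrange = solve-∀

  -- Sums over subsets

  ∑ˢ : ∀ {n} → (Subset n → ℕ) → ℕ
  ∑ˢ {n} f = sumᴸ (map f (allSubsets n))

  ∑ˢ-suc : ∀ {n} (f : Subset (suc n) → ℕ) → ∑ˢ f ≡ ∑ˢ (f ∘ (false ∷_)) + ∑ˢ (f ∘ (true ∷_))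
  ∑ˢ-suc {n} f = begin
    sumᴸ (map f (map (false ∷_) S ++ map (true ∷_) S))               ≡⟨ cong sumᴸ (map-++ f (map (false ∷_) S) _) ⟩
    sumᴸ (map f (map (false ∷_) S) ++ map f (map (true ∷_) S))       ≡⟨ sum-++ (map f (map (false ∷_) S)) _ ⟩
    sumᴸ (map f (map (false ∷_) S)) + sumᴸ (map f (map (true ∷_) S)) ≡⟨ cong₂ (λ x y → sumᴸ x + sumᴸ y) (map-∘ S) (map-∘ S) ⟨
    ∑ˢ (f ∘ (false ∷_)) + ∑ˢ (f ∘ (true ∷_))                         ∎
    where
    open ≡-Reasoning
    S : List (Subset n)
    S = allSubsets n

  module _ {A : Set} where

    sum-map-mono : ∀ {f g : A → ℕ} → (∀ x → f x ≤ g x) → ∀ xs → sumᴸ (map f xs) ≤ sumᴸ (map g xs)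
    sum-map-mono f≤g []       = ≤-refl
    sum-map-mono f≤g (x ∷ xs) = +-mono-≤ (f≤g x) (sum-map-mono f≤g xs)

    sum-map-+ : ∀ (f g : A → ℕ) xs → sumᴸ (map (λ x → f x + g x) xs) ≡ sumᴸ (map f xs) + sumᴸ (map g xs)
    sum-map-+ f g []       = refl
    sum-map-+ f g (x ∷ xs) = trans (cong (f x + g x +_) (sum-map-+ f g xs)) (interchange (f x) (g x) _ _)
      where
      interchange : ∀ a b c d → a + b + (c + d) ≡ a + c + (b + d)
      interchange = solve-∀

    sum-map-* : ∀ c (f : A → ℕ) xs → sumᴸ (map (λ x → c * f x) xs) ≡ c * sumᴸ (map f xs)
    sum-map-* c f []       = sym (*-zeroʳ c)
    sum-map-* c f (x ∷ xs) = trans (cong (c * f x +_) (sum-map-* c f xs)) (sym (*-distribˡ-+ c (f x) _))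

    sum-map-∑ : ∀ {n} (f : Fin n → A → ℕ) xs →
                sumᴸ (map (λ x → ∑ (λ i → f i x)) xs) ≡ ∑ (λ i → sumᴸ (map (f i) xs))
    sum-map-∑ f []       = sym (∑-zero (λ i → sumᴸ (map (f i) [])) λ _ → refl)
    sum-map-∑ f (x ∷ xs) = trans (cong (∑ (λ i → f i x) +_) (sum-map-∑ f xs)) (sym (∑.∑-distrib-+ (λ i → f i x) _))

  -- Distributive law: expanding the product on the right chooses "out" or "in" at each `i`, that
  -- is, one subset. A weight that factors over the vertices can thus be summed vertex by vertex.
  ∑ˢ-∏ : ∀ {n} (w : Fin n → Bool → ℕ) →
         ∑ˢ (λ I → ∏ (λ i → w i (lookup I i))) ≡ ∏ (λ i → w i false + w i true)
  ∑ˢ-∏ {zero}  w = refl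
  ∑ˢ-∏ {suc n} w = begin
    ∑ˢ (λ I → ∏ (λ i → w i (lookup I i)))                    ≡⟨ ∑ˢ-suc (λ I → ∏ (λ i → w i (lookup I i))) ⟩
    ∑ˢ (λ I → w zero false * P I) + ∑ˢ (λ I → w zero true * P I)
      ≡⟨ cong₂ _+_ (sum-map-* (w zero false) P (allSubsets n)) (sum-map-* (w zero true) P (allSubsets n)) ⟩
    w zero false * ∑ˢ P + w zero true * ∑ˢ P                 ≡⟨ *-distribʳ-+ (∑ˢ P) (w zero false) _ ⟨
    (w zero false + w zero true) * ∑ˢ P                      ≡⟨ cong ((w zero false + w zero true) *_) (∑ˢ-∏ (w ∘ suc)) ⟩
    ∏ (λ i → w i false + w i true)                           ∎
    where
    open ≡-Reasoning
    P : Subset n → ℕ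
    P I = ∏ (λ i → w (suc i) (lookup I i))

  ∏-const2 : ∀ n → ∏ {n} (λ _ → 2) ≡ 2 ^ n
  ∏-const2 zero    = refl
  ∏-const2 (suc n) = cong (2 *_) (∏-const2 n)

  ∑ˢ-one : ∀ n → ∑ˢ {n} (λ _ → 1) ≡ 2 ^ n
  ∑ˢ-one zero    = refl
  ∑ˢ-one (suc n) = trans (∑ˢ-suc {n} (λ _ → 1))
    (trans (cong₂ _+_ (∑ˢ-one n) (∑ˢ-one n)) (cong (2 ^ n +_) (sym (+-identityʳ _))))

  -- Indicator of membership of `x`, doubled so that its weights 0 and 2 add up to 2, just as the
  -- weights 1 and 1 do elsewhere. Every vertex then contributes the same factor, and no exponent
  -- has to be lowered.
  marked : ∀ {n} → Fin n → Fin n → Bool → ℕ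
  marked x i b = if does (x ≟ i) then 2 * 𝟙 b else 1

  ∏-marked : ∀ {n} (x : Fin n) (I : Subset n) → ∏ (λ i → marked x i (lookup I i)) ≡ 2 * 𝟙 (lookup I x)
  ∏-marked {suc n} zero    (b ∷ I) = trans (cong (2 * 𝟙 b *_) (∏.sum-replicate-zero n)) (*-identityʳ _)
  ∏-marked {suc n} (suc x) (b ∷ I) = trans (*-identityˡ _) (∏-marked x I)

  marked-sum₂ : ∀ {n} {x y : Fin n} → x ≢ y → ∀ i →
                marked x i false * marked y i false + marked x i true * marked y i true ≡ 2
  marked-sum₂ {x = x} {y} x≢y i with x ≟ i | y ≟ i
  ... | yes refl | yes refl = contradiction refl x≢y
  ... | yes _    | no _     = refl
  ... | no _     | yes _    = refl
  ... | no _     | no _     = refl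

  -- A quarter of all subsets contain two given distinct points; the 4 is the product of the two
  -- doublings in `marked`.
  ∑ˢ-pair : ∀ {n} {x y : Fin n} → x ≢ y → ∑ˢ (λ I → 4 * (𝟙 (lookup I x) * 𝟙 (lookup I y))) ≡ 2 ^ n
  ∑ˢ-pair {n} {x} {y} x≢y = begin
    ∑ˢ (λ I → 4 * (𝟙 (lookup I x) * 𝟙 (lookup I y)))                    ≡⟨ cong sumᴸ (map-cong as-product (allSubsets n)) ⟩
    ∑ˢ (λ I → ∏ (λ i → marked x i (lookup I i) * marked y i (lookup I i))) ≡⟨ ∑ˢ-∏ (λ i b → marked x i b * marked y i b) ⟩
    ∏ (λ i → marked x i false * marked y i false + marked x i true * marked y i true)
      ≡⟨ ∏.sum-cong-≗ (marked-sum₂ x≢y) ⟩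
    ∏ {n} (λ _ → 2)                                                        ≡⟨ ∏-const2 n ⟩
    2 ^ n                                                                  ∎
    where
    open ≡-Reasoning
    regroup : ∀ a b → 4 * (a * b) ≡ 2 * a * (2 * b)
    regroup = solve-∀
    as-product : ∀ I → 4 * (𝟙 (lookup I x) * 𝟙 (lookup I y)) ≡ ∏ (λ i → marked x i (lookup I i) * marked y i (lookup I i))
    as-product I = trans (regroup (𝟙 (lookup I x)) _)
      (sym (trans (∏.∑-distrib-+ (λ i → marked x i (lookup I i)) _) (cong₂ _*_ (∏-marked x I) (∏-marked y I))))

  -- Filtered lists as sums, and minima over members

  length-filter-tabulate : ∀ {A : Set} {P : Pred A 0ℓ} (P? : Decidable P) {n} (f : Fin n → A) →
    length (filter P? (tabulate f)) ≡ ∑ (λ i → 𝟙 (does (P? (f i))))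
  length-filter-tabulate P? {zero}  f = refl
  length-filter-tabulate P? {suc n} f with does (P? (f zero))
  ... | true  = cong suc (length-filter-tabulate P? (f ∘ suc))
  ... | false = length-filter-tabulate P? (f ∘ suc)

  all-∈ : ∀ {A : Set} (p : A → Bool) {x} xs → all p xs ≡ true → x ∈ xs → p x ≡ true
  all-∈ p (y ∷ xs) eq x∈ with p y in py
  all-∈ p (y ∷ xs) eq (here refl) | true = py
  all-∈ p (y ∷ xs) eq (there x∈)  | true = all-∈ p xs eq x∈

  minList-≤ : ∀ {A : Set} (f : A → ℕ) {x} xs → x ∈ xs → minList (map f xs) ≤ f x
  minList-≤ f (y ∷ [])     (here refl) = ≤-refl
  minList-≤ f (y ∷ z ∷ xs) (here refl) = m⊓n≤m (f y) _
  minList-≤ f (y ∷ z ∷ xs) (there x∈)  = ≤-trans (m⊓n≤n (f y) _) (minList-≤ f (z ∷ xs) x∈)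

  minList-attained : ∀ {A : Set} (f : A → ℕ) y xs → ∃ λ x → x ∈ y ∷ xs × minList (map f (y ∷ xs)) ≡ f x
  minList-attained f y []       = y , here refl , refl
  minList-attained f y (z ∷ xs) with ⊓-sel (f y) (minList (map f (z ∷ xs))) | minList-attained f z xs
  ... | inj₁ eq | _            = y , here refl , eq
  ... | inj₂ eq | x , x∈ , eq′ = x , there x∈ , trans eq eq′

  lookup⇒∈members : ∀ {n} (I : Subset n) {x} → lookup I x ≡ true → x ∈ members I
  lookup⇒∈members I {x} x∈I = ∈-filter⁺ (λ x → lookup I x ≟ᵇ true) (∈-allFin x) x∈I

  ∈members⇒lookup : ∀ {n} (I : Subset n) {x} → x ∈ members I → lookup I x ≡ true
  ∈members⇒lookup I x∈ = proj₂ (∈-filter⁻ (λ x → lookup I x ≟ᵇ true) {xs = allFin _} x∈)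

  does-true : ∀ {P : Set} (P? : Dec P) → does P? ≡ true → P
  does-true (yes p) _ = p

  -- Leaves and degrees

  module _ {s} (R : Graph s) where

    private
      d : Fin s → ℕ
      d = degree R

    leaf : Fin s → Bool
    leaf x = does (d x ≟ⁿ 1)

    leaf⇒d≡1 : ∀ x → leaf x ≡ true → d x ≡ 1
    leaf⇒d≡1 x = does-true (d x ≟ⁿ 1)

    leaves nonleaves : ℕ
    leaves    = ∑ (𝟙 ∘ leaf)
    nonleaves = ∑ (𝟙 ∘ not ∘ leaf)

    numDegOne≡leaves : numDegOne R ≡ leaves
    numDegOne≡leaves = length-filter-tabulate (λ x → d x ≟ⁿ 1) (λ x → x)

    leaves+nonleaves : leaves + nonleaves ≡ s
    leaves+nonleaves = trans (sym (∑.∑-distrib-+ (𝟙 ∘ leaf) _)) (trans (∑.sum-cong-≗ (λ i → case (leaf i))) (∑-one s))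
      where
      case : ∀ b → 𝟙 b + 𝟙 (not b) ≡ 1
      case true  = refl
      case false = refl
      ∑-one : ∀ n → ∑ {n} (λ _ → 1) ≡ n
      ∑-one zero    = refl
      ∑-one (suc n) = cong suc (∑-one n)

    degree-∑ : ∀ x → d x ≡ ∑ (λ y → 𝟙 (adj R x y))
    degree-∑ x = trans (length-filter-tabulate (λ y → adj R x y ≟ᵇ true) (λ y → y))
                       (∑.sum-cong-≗ (λ y → cong 𝟙 (does-≟-true (adj R x y))))
      where
      does-≟-true : ∀ b → does (b ≟ᵇ true) ≡ b
      does-≟-true true  = refl
      does-≟-true false = refl

    leafDegree : Fin s → ℕ
    leafDegree x = ∑ (λ i → 𝟙 (leaf i) * 𝟙 (adj R x i))

    -- Double counting: after exchanging the sums, each leaf contributes its degree, which is 1.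
    -- Equality holds because `x` ranges over all vertices, leaves included.
    ∑-leafDegree : ∑ leafDegree ≡ leaves
    ∑-leafDegree = begin
      ∑ (λ x → ∑ (λ i → 𝟙 (leaf i) * 𝟙 (adj R x i)))  ≡⟨ ∑.∑-comm (λ x i → 𝟙 (leaf i) * 𝟙 (adj R x i)) ⟩
      ∑ (λ i → ∑ (λ x → 𝟙 (leaf i) * 𝟙 (adj R x i)))  ≡⟨ ∑.sum-cong-≗ step ⟩
      ∑ (𝟙 ∘ leaf)                                    ∎
      where
      open ≡-Reasoning
      step : ∀ i → ∑ (λ x → 𝟙 (leaf i) * 𝟙 (adj R x i)) ≡ 𝟙 (leaf i)
      step i with leaf i in eq
      ... | false = ∑-zero {s} (λ _ → 0) λ _ → refl
      ... | true  = trans (sym (*-distribˡ-sum 1 (λ x → 𝟙 (adj R x i)))) (trans (*-identityˡ _)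
            (trans (∑.sum-cong-≗ (λ x → cong 𝟙 (Graph.sym R x i))) (trans (sym (degree-∑ i)) (leaf⇒d≡1 i eq))))

    -- Subsets avoiding the leaves

    avoidsLeaves : Subset s → ℕ
    avoidsLeaves I = ∏ (λ i → if lookup I i then 𝟙 (not (leaf i)) else 1)

    ∑ˢ-avoidsLeaves : ∑ˢ avoidsLeaves ≡ 2 ^ nonleaves
    ∑ˢ-avoidsLeaves = trans (∑ˢ-∏ (λ i b → if b then 𝟙 (not (leaf i)) else 1))
      (trans (∏.sum-cong-≗ (λ i → case (leaf i))) (∏-2^ (𝟙 ∘ not ∘ leaf)))
      where
      case : ∀ b → 1 + 𝟙 (not b) ≡ 2 ^ 𝟙 (not b)
      case true  = refl
      case false = refl

    avoidsLeaves≤1 : ∀ I → avoidsLeaves I ≤ 1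
    avoidsLeaves≤1 I = ∏≤1 (λ i → case (lookup I i) (leaf i))
      where
      case : ∀ b c → (if b then 𝟙 (not c) else 1) ≤ 1
      case false _     = ≤-refl
      case true  false = ≤-refl
      case true  true  = z≤n

    avoidsLeaves≡0 : ∀ I i → lookup I i ≡ true → leaf i ≡ true → avoidsLeaves I ≡ 0
    avoidsLeaves≡0 I i i∈I i∈L = ∏-zero i (cong₂ (λ b c → if b then 𝟙 (not c) else 1) i∈I i∈L)

    -- The charge of a vertex

    free : Fin s → Fin s → Bool → ℕ
    free x i b = if b then 𝟙 (not (leaf i) ∧ not (adj R x i)) else 2 ^ 𝟙 (adj R x i)

    -- Equals 2 · 2^d(x) when x ∈ I and I avoids the leaves and the neighbours of x,
    -- and 0 otherwise; the factor 2^d(x) sits at the neighbours of x and the 2 at x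
    -- itself, so that summing over I is a product over the vertices.
    charge : Fin s → Subset s → ℕ
    charge x I = ∏ (λ i → marked x i (lookup I i) * free x i (lookup I i))

    -- The vertex `x` itself contributes 0 + 2, as it is neither a leaf nor its own neighbour. Any
    -- other non-leaf contributes 2: as 2 + 0 if adjacent to `x`, as 1 + 1 if not. So forbidding the
    -- neighbours costs exactly what the weight 2^d(x) gains, except at leaves, which are forbidden
    -- anyway: a leaf contributes 2 if adjacent to `x` and 1 if not.
    ∑ˢ-charge : ∀ x → leaf x ≡ false → ∑ˢ (charge x) ≡ 2 ^ nonleaves * 2 ^ leafDegree x
    ∑ˢ-charge x x∉L = begin
      ∑ˢ (charge x)                                          ≡⟨ ∑ˢ-∏ (λ i b → marked x i b * free x i b) ⟩
      ∏ (λ i → marked x i false * free x i false + marked x i true * free x i true)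
                                                             ≡⟨ ∏.sum-cong-≗ factor ⟩
      ∏ (λ i → 2 ^ 𝟙 (not (leaf i)) * 2 ^ (𝟙 (leaf i) * 𝟙 (adj R x i)))
                                                             ≡⟨ ∏.∑-distrib-+ (λ i → 2 ^ 𝟙 (not (leaf i))) _ ⟩
      ∏ (λ i → 2 ^ 𝟙 (not (leaf i))) * ∏ (λ i → 2 ^ (𝟙 (leaf i) * 𝟙 (adj R x i)))
                                                             ≡⟨ cong₂ _*_ (∏-2^ (𝟙 ∘ not ∘ leaf)) (∏-2^ (λ i → 𝟙 (leaf i) * 𝟙 (adj R x i))) ⟩
      2 ^ nonleaves * 2 ^ leafDegree x                       ∎
      where
      open ≡-Reasoning
      factor : ∀ i → marked x i false * free x i false + marked x i true * free x i true
                     ≡ 2 ^ 𝟙 (not (leaf i)) * 2 ^ (𝟙 (leaf i) * 𝟙 (adj R x i))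
      factor i with x ≟ i
      ... | yes refl rewrite x∉L | irrefl R x = refl
      ... | no _ with leaf i | adj R x i
      ...   | true  | true  = refl
      ...   | true  | false = refl
      ...   | false | true  = refl
      ...   | false | false = refl

    totalCharge : Subset s → ℕ
    totalCharge I = ∑ (λ x → 𝟙 (not (leaf x)) * charge x I)

    -- The summand `2 ^ nonleaves` on the left is the 1 of `∑2^≤2^∑`, scaled; it is kept there to
    -- avoid truncated subtraction.
    ∑ˢ-totalCharge : ∑ˢ totalCharge + 2 ^ nonleaves ≤ 2 ^ nonleaves * (2 ^ leaves + nonleaves)
    ∑ˢ-totalCharge = begin
      ∑ˢ totalCharge + M                                         ≡⟨ cong (_+ M) (sum-map-∑ (λ x I → 𝟙 (not (leaf x)) * charge x I) (allSubsets s)) ⟩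
      ∑ (λ x → ∑ˢ (λ I → 𝟙 (not (leaf x)) * charge x I)) + M     ≡⟨ cong (_+ M) (∑.sum-cong-≗ term) ⟩
      ∑ (λ x → M * (𝟙 (not (leaf x)) * 2 ^ leafDegree x)) + M    ≡⟨ cong (_+ M) (*-distribˡ-sum M (λ x → 𝟙 (not (leaf x)) * 2 ^ leafDegree x)) ⟨
      M * T + M                                                  ≡⟨ factor M T ⟩
      M * (1 + T)                                                ≤⟨ *-monoʳ-≤ M (∑2^≤2^∑ (not ∘ leaf) leafDegree) ⟩
      M * (2 ^ ∑ leafDegree + nonleaves)                         ≡⟨ cong (λ l → M * (2 ^ l + nonleaves)) ∑-leafDegree ⟩
      M * (2 ^ leaves + nonleaves)                               ∎
      where
      open ≤-Reasoning
      M T : ℕ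
      M = 2 ^ nonleaves
      T = ∑ (λ x → 𝟙 (not (leaf x)) * 2 ^ leafDegree x)
      factor : ∀ M T → M * T + M ≡ M * (1 + T)
      factor = solve-∀
      swap : ∀ M w → 1 * (M * w) ≡ M * (1 * w)
      swap = solve-∀
      term : ∀ x → ∑ˢ (λ I → 𝟙 (not (leaf x)) * charge x I) ≡ M * (𝟙 (not (leaf x)) * 2 ^ leafDegree x)
      term x with leaf x in eq
      ... | true  = trans (sum-map-* 0 (charge x) (allSubsets s)) (sym (*-zeroʳ M))
      ... | false = trans (sum-map-* 1 (charge x) (allSubsets s))
                      (trans (cong (1 *_) (∑ˢ-charge x eq)) (swap M _))

    -- The loss of a single set

    loss : Subset s → ℕ
    loss I = if isIndependent R I ∧ isNonempty I then 2 ^ δ R I ∸ 1 else 0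

    Independent : Subset s → Set
    Independent I = ∀ x y → lookup I x ≡ true → lookup I y ≡ true → adj R x y ≡ false

    isIndependent⇒Independent : ∀ I → isIndependent R I ≡ true → Independent I
    isIndependent⇒Independent I ind x y x∈I y∈I = not-true (adj R x y)
      (all-∈ (λ y → not (adj R x y)) (members I)
        (all-∈ (λ x → all (λ y → not (adj R x y)) (members I)) (members I) ind (lookup⇒∈members I x∈I))
        (lookup⇒∈members I y∈I))
      where
      not-true : ∀ b → not b ≡ true → b ≡ false
      not-true false _ = refl

    δ-attained : ∀ I → isNonempty I ≡ true → ∃ λ z → lookup I z ≡ true × δ R I ≡ d z
    δ-attained I ne with members I in eq
    -- The hypothesis `ne` excludes the empty list, on which `minList` takes its default value.
    ... | y ∷ ys with minList-attained d y ys
    ...   | z , z∈ , δ≡ = z , ∈members⇒lookup I (subst (z ∈_) (sym eq) z∈) , δ≡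

    -- A member of `I` is neither a leaf nor adjacent to `z`, so its factor is 1 = 2^0. Hence every
    -- vertex carries the factor `2 ^ 𝟙 (adj R z i)`, and the exponents add up to the degree of `z`.
    charge-min : ∀ I → Independent I → (∀ i → lookup I i ≡ true → leaf i ≡ false) →
                 ∀ z → lookup I z ≡ true → charge z I ≡ 2 * 2 ^ d z
    charge-min I ind noLeaf z z∈I = begin
      charge z I                                         ≡⟨ ∏.∑-distrib-+ (λ i → marked z i (lookup I i)) _ ⟩
      ∏ (λ i → marked z i (lookup I i)) * ∏ (λ i → free z i (lookup I i))
                                                         ≡⟨ cong₂ _*_ (∏-marked z I) (∏.sum-cong-≗ factor) ⟩
      2 * 𝟙 (lookup I z) * ∏ (λ i → 2 ^ 𝟙 (adj R z i))   ≡⟨ cong₂ (λ b p → 2 * 𝟙 b * p) z∈I (∏-2^ (λ i → 𝟙 (adj R z i))) ⟩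
      2 * 2 ^ ∑ (λ i → 𝟙 (adj R z i))                    ≡⟨ cong (λ e → 2 * 2 ^ e) (degree-∑ z) ⟨
      2 * 2 ^ d z                                        ∎
      where
      open ≡-Reasoning
      factor : ∀ i → free z i (lookup I i) ≡ 2 ^ 𝟙 (adj R z i)
      factor i with lookup I i in i∈I
      ... | false = refl
      ... | true rewrite noLeaf i i∈I | ind z i z∈I i∈I = refl

    data LossBound (I : Subset s) : Set where
      zeroLoss   : loss I ≡ 0 → LossBound I
      meetsLeaf  : Independent I → ∀ i → lookup I i ≡ true → leaf i ≡ true → loss I ≤ 1 → LossBound I
      avoidsLeaf : (∀ i → lookup I i ≡ true → leaf i ≡ false) → 2 * loss I ≤ totalCharge I → LossBound I

    -- A leaf in `I` forces `δ R I ≤ 1`, hence a loss of at most 2^1 - 1 = 1. If there is none, the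
    -- charge of a member of minimum degree already covers twice the loss.
    lossBound : ∀ I → LossBound I
    lossBound I with isIndependent R I in ind | isNonempty I in ne
    ... | false | _     = zeroLoss (cong (λ b → if b ∧ isNonempty I then 2 ^ δ R I ∸ 1 else 0) ind)
    ... | true  | false = zeroLoss (cong₂ (λ b c → if b ∧ c then 2 ^ δ R I ∸ 1 else 0) ind ne)
    ... | true  | true  with any? (λ i → (lookup I i ≟ᵇ true) ×-dec (leaf i ≟ᵇ true))
    ...   | yes (i , i∈I , i∈L) = meetsLeaf (isIndependent⇒Independent I ind) i i∈I i∈L
              (subst (_≤ 1) (sym loss≡) (∸-monoˡ-≤ 1 (^-monoʳ-≤ 2 δ≤1)))
      where
      loss≡ : loss I ≡ 2 ^ δ R I ∸ 1
      loss≡ = cong₂ (λ b c → if b ∧ c then 2 ^ δ R I ∸ 1 else 0) ind ne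
      δ≤1 : δ R I ≤ 1
      δ≤1 = subst (δ R I ≤_) (leaf⇒d≡1 i i∈L) (minList-≤ d (members I) (lookup⇒∈members I i∈I))
    ...   | no noLeaf = avoidsLeaf noLeaf′ bound
      where
      open ≤-Reasoning
      noLeaf′ : ∀ i → lookup I i ≡ true → leaf i ≡ false
      noLeaf′ i i∈I with leaf i in eq
      ... | false = refl
      ... | true  = contradiction (i , i∈I , eq) noLeaf
      bound : 2 * loss I ≤ totalCharge I
      bound with δ-attained I ne
      ... | z , z∈I , δ≡ = begin
        2 * loss I                       ≡⟨ cong (2 *_) (cong₂ (λ b c → if b ∧ c then 2 ^ δ R I ∸ 1 else 0) ind ne) ⟩
        -- The `∸ 1` is given up for sets avoiding the leaves; it matters only for sets meeting
        -- them.
        2 * (2 ^ δ R I ∸ 1)              ≤⟨ *-monoʳ-≤ 2 (m∸n≤m (2 ^ δ R I) 1) ⟩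
        2 * 2 ^ δ R I                    ≡⟨ cong (λ e → 2 * 2 ^ e) δ≡ ⟩
        2 * 2 ^ d z                      ≡⟨ charge-min I (isIndependent⇒Independent I ind) noLeaf′ z z∈I ⟨
        charge z I                       ≡⟨ *-identityˡ _ ⟨
        1 * charge z I                   ≡⟨ cong (λ b → 𝟙 (not b) * charge z I) (noLeaf′ z z∈I) ⟨
        𝟙 (not (leaf z)) * charge z I    ≤⟨ f≤∑f (λ x → 𝟙 (not (leaf x)) * charge x I) z ⟩
        totalCharge I                    ∎

    loss-noLeaves : (∀ i → leaf i ≡ false) → ∀ I → 2 * loss I ≤ totalCharge I
    loss-noLeaves noLeaf I with lossBound I
    ... | zeroLoss eq           = subst (λ l → 2 * l ≤ totalCharge I) (sym eq) z≤n
    ... | meetsLeaf _ i _ i∈L _ = contradiction (trans (sym i∈L) (noLeaf i)) λ ()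
    ... | avoidsLeaf _ le       = le

    -- Three classes of sets are pairwise disjoint: independent and meeting the leaves, avoiding the
    -- leaves, containing both `x` and `y`. The constant 4 therefore pays for whichever class `I`
    -- belongs to, and `totalCharge` pays for the loss of a set avoiding the leaves. Summed over
    -- `I`, this is the count 3·2^(s-2) - 2^m, scaled by 4.
    loss-edge : ∀ x y → leaf x ≡ true → adj R x y ≡ true → ∀ I →
      4 * loss I + 4 * avoidsLeaves I + 4 * (𝟙 (lookup I x) * 𝟙 (lookup I y)) ≤ 4 * 1 + 2 * totalCharge I
    loss-edge x y x∈L xy I with lossBound I
    ... | meetsLeaf ind i i∈I i∈L le = begin
        4 * loss I + 4 * avoidsLeaves I + 4 * (𝟙 (lookup I x) * 𝟙 (lookup I y))
          ≡⟨ cong₂ (λ a p → 4 * loss I + 4 * a + 4 * p) (avoidsLeaves≡0 I i i∈I i∈L) noEdge ⟩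
        4 * loss I + 0 + 0        ≡⟨ trans (+-identityʳ _) (+-identityʳ _) ⟩
        4 * loss I                ≤⟨ *-monoʳ-≤ 4 le ⟩
        4 * 1                     ≤⟨ m≤m+n _ _ ⟩
        4 * 1 + 2 * totalCharge I ∎
      where
      open ≤-Reasoning
      noEdge : 𝟙 (lookup I x) * 𝟙 (lookup I y) ≡ 0
      noEdge with lookup I x in x∈I | lookup I y in y∈I
      ... | false | _     = refl
      ... | true  | false = refl
      ... | true  | true  = contradiction (trans (sym xy) (ind x y x∈I y∈I)) λ ()
    ... | avoidsLeaf noLeaf le = begin
        4 * loss I + 4 * avoidsLeaves I + 4 * (𝟙 (lookup I x) * 𝟙 (lookup I y))
          ≡⟨ cong (λ b → 4 * loss I + 4 * avoidsLeaves I + 4 * (𝟙 b * 𝟙 (lookup I y))) x∉I ⟩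
        4 * loss I + 4 * avoidsLeaves I + 0   ≡⟨ +-identityʳ _ ⟩
        4 * loss I + 4 * avoidsLeaves I       ≤⟨ +-monoʳ-≤ (4 * loss I) (*-monoʳ-≤ 4 (avoidsLeaves≤1 I)) ⟩
        4 * loss I + 4 * 1                    ≡⟨ regroup (loss I) ⟩
        4 * 1 + 2 * (2 * loss I)              ≤⟨ +-monoʳ-≤ 4 (*-monoʳ-≤ 2 le) ⟩
        4 * 1 + 2 * totalCharge I             ∎
      where
      open ≤-Reasoning
      regroup : ∀ l → 4 * l + 4 * 1 ≡ 4 * 1 + 2 * (2 * l)
      regroup = solve-∀
      x∉I : lookup I x ≡ false
      x∉I with lookup I x in x∈I
      ... | false = refl
      ... | true  = contradiction (trans (sym x∈L) (noLeaf x x∈I)) λ ()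
    -- Here `I` is empty or not independent, so it may avoid the leaves or contain the edge; it
    -- cannot do both, since `x` is a leaf.
    ... | zeroLoss eq = begin
        4 * loss I + 4 * avoidsLeaves I + 4 * (𝟙 (lookup I x) * 𝟙 (lookup I y))
          ≡⟨ cong (λ l → 4 * l + 4 * avoidsLeaves I + 4 * (𝟙 (lookup I x) * 𝟙 (lookup I y))) eq ⟩
        4 * avoidsLeaves I + 4 * (𝟙 (lookup I x) * 𝟙 (lookup I y))
          ≤⟨ exclusive ⟩
        4 * 1                     ≤⟨ m≤m+n _ _ ⟩
        4 * 1 + 2 * totalCharge I ∎
      where
      open ≤-Reasoning
      𝟙≤1 : ∀ b → 𝟙 b ≤ 1
      𝟙≤1 true  = ≤-refl
      𝟙≤1 false = z≤n
      exclusive : 4 * avoidsLeaves I + 4 * (𝟙 (lookup I x) * 𝟙 (lookup I y)) ≤ 4 * 1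
      exclusive with lookup I x in x∈I
      ... | false = ≤-trans (≤-reflexive (+-identityʳ _)) (*-monoʳ-≤ 4 (avoidsLeaves≤1 I))
      ... | true  = subst (λ a → 4 * a + 4 * (1 * 𝟙 (lookup I y)) ≤ 4) (sym (avoidsLeaves≡0 I x x∈I x∈L))
                      (*-monoʳ-≤ 4 (≤-trans (≤-reflexive (*-identityˡ _)) (𝟙≤1 (lookup I y))))

    -- Summation over all sets

    2^s-split : 2 ^ s ≡ 2 ^ nonleaves * 2 ^ leaves
    2^s-split = trans (cong (2 ^_) (trans (sym leaves+nonleaves) (+-comm leaves nonleaves))) (^-distribˡ-+-* 2 nonleaves leaves)

    leaf⇒neighbour : ∀ x → leaf x ≡ true → ∃ λ y → adj R x y ≡ true
    leaf⇒neighbour x x∈L with any? (λ y → adj R x y ≟ᵇ true)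
    ... | yes p = p
    ... | no ¬p = contradiction (trans (sym (leaf⇒d≡1 x x∈L)) (trans (degree-∑ x) (∑-zero (λ y → 𝟙 (adj R x y)) zeroes))) λ ()
      where
      zeroes : ∀ y → 𝟙 (adj R x y) ≡ 0
      zeroes y with adj R x y in eq
      ... | true  = contradiction (y , eq) ¬p
      ... | false = refl

    -- With m = `nonleaves`, the term `4 * 2 ^ nonleaves` is the negative part of (m - 2)·2^(m+1),
    -- moved to the left.
    4fl-bound : 4 * fl R + 4 * 2 ^ nonleaves ≤ 5 * 2 ^ s + 2 * (2 ^ nonleaves * nonleaves)
    4fl-bound with any? (λ i → leaf i ≟ᵇ true)
    ... | no noLeaf = +-cancelʳ-≤ (2 * M) _ _ (begin
        4 * F + 4 * M + 2 * M                ≡⟨ regroup₁ F M ⟩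
        2 * (2 * F + M) + 4 * M              ≤⟨ +-monoˡ-≤ (4 * M) (*-monoʳ-≤ 2 (+-monoˡ-≤ M 2F≤)) ⟩
        2 * (∑ˢ totalCharge + M) + 4 * M     ≤⟨ +-monoˡ-≤ (4 * M) (*-monoʳ-≤ 2 ∑ˢ-totalCharge) ⟩
        2 * (M * (K + nonleaves)) + 4 * M    ≡⟨ cong (λ k → 2 * (M * (2 ^ k + nonleaves)) + 4 * M) (∑-zero (𝟙 ∘ leaf) λ i → cong 𝟙 (noLeaf′ i)) ⟩
        -- Apart from `2 * (M * nonleaves)`, there are 6 copies of `M` here against 7 in the goal,
        -- so one is to spare. Without the summand `M` of `∑ˢ-totalCharge` it would be 6 against 5.
        2 * (M * (1 + nonleaves)) + 4 * M    ≤⟨ m≤m+n _ M ⟩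
        2 * (M * (1 + nonleaves)) + 4 * M + M ≡⟨ regroup₂ M nonleaves ⟩
        5 * (M * 1) + 2 * (M * nonleaves) + 2 * M ≡⟨ cong (λ S → 5 * S + 2 * (M * nonleaves) + 2 * M) S≡ ⟨
        5 * 2 ^ s + 2 * (M * nonleaves) + 2 * M ∎)
      where
      open ≤-Reasoning
      F M K : ℕ
      F = fl R
      M = 2 ^ nonleaves
      K = 2 ^ leaves
      noLeaf′ : ∀ i → leaf i ≡ false
      noLeaf′ i with leaf i in eq
      ... | true  = contradiction (i , eq) noLeaf
      ... | false = refl
      S≡ : 2 ^ s ≡ M * 1
      S≡ = trans 2^s-split (cong (λ k → M * 2 ^ k) (∑-zero (𝟙 ∘ leaf) λ i → cong 𝟙 (noLeaf′ i)))
      2F≤ : 2 * F ≤ ∑ˢ totalCharge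
      2F≤ = ≤-trans (≤-reflexive (sym (sum-map-* 2 loss (allSubsets s))))
                    (sum-map-mono (loss-noLeaves noLeaf′) (allSubsets s))
      regroup₁ : ∀ F M → 4 * F + 4 * M + 2 * M ≡ 2 * (2 * F + M) + 4 * M
      regroup₁ = solve-∀
      regroup₂ : ∀ M m → 2 * (M * (1 + m)) + 4 * M + M ≡ 5 * (M * 1) + 2 * (M * m) + 2 * M
      regroup₂ = solve-∀
    ... | yes (x , x∈L) with leaf⇒neighbour x x∈L
    -- The added `2 ^ s` is four times the number of sets containing both `x` and `y`. The
    -- coefficient 5 arises as 4 + 2 - 1: all sets, the product `M * K`, and the sets containing the
    -- edge.
    ...   | y , xy = +-cancelʳ-≤ (2 ^ s) _ _ (begin
        4 * F + 4 * M + S                    ≤⟨ summed ⟩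
        -- In this case the summand `M` of `∑ˢ-totalCharge` is dropped.
        4 * S + 2 * ∑ˢ totalCharge           ≤⟨ +-monoʳ-≤ (4 * S) (*-monoʳ-≤ 2 (m+n≤o⇒m≤o (∑ˢ totalCharge) ∑ˢ-totalCharge)) ⟩
        4 * S + 2 * (M * (K + nonleaves))    ≡⟨ regroup S M K nonleaves ⟩
        4 * S + 2 * (M * K) + 2 * (M * nonleaves) ≡⟨ cong (λ t → 4 * S + 2 * t + 2 * (M * nonleaves)) 2^s-split ⟨
        4 * S + 2 * S + 2 * (M * nonleaves)  ≡⟨ regroup₂ S (M * nonleaves) ⟩
        5 * S + 2 * (M * nonleaves) + S      ∎)
      where
      open ≤-Reasoning
      F M K S : ℕ
      F = fl R
      M = 2 ^ nonleaves
      K = 2 ^ leaves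
      S = 2 ^ s
      pair : Subset s → ℕ
      pair I = 4 * (𝟙 (lookup I x) * 𝟙 (lookup I y))
      x≢y : x ≢ y
      x≢y refl = contradiction (trans (sym xy) (irrefl R x)) λ ()
      lhs : ∑ˢ (λ I → 4 * loss I + 4 * avoidsLeaves I + pair I) ≡ 4 * F + 4 * M + S
      lhs = trans (sum-map-+ (λ I → 4 * loss I + 4 * avoidsLeaves I) pair (allSubsets s))
        (cong₂ _+_ (trans (sum-map-+ (λ I → 4 * loss I) (λ I → 4 * avoidsLeaves I) (allSubsets s))
                     (cong₂ _+_ (sum-map-* 4 loss (allSubsets s))
                                (trans (sum-map-* 4 avoidsLeaves (allSubsets s)) (cong (4 *_) ∑ˢ-avoidsLeaves))))
                   (∑ˢ-pair x≢y))
      rhs : ∑ˢ (λ I → 4 * 1 + 2 * totalCharge I) ≡ 4 * S + 2 * ∑ˢ totalCharge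
      rhs = trans (sum-map-+ (λ _ → 4 * 1) (λ I → 2 * totalCharge I) (allSubsets s))
        (cong₂ _+_ (trans (sum-map-* 4 (λ _ → 1) (allSubsets s)) (cong (4 *_) (∑ˢ-one s)))
                   (sum-map-* 2 totalCharge (allSubsets s)))
      summed : 4 * F + 4 * M + S ≤ 4 * S + 2 * ∑ˢ totalCharge
      summed = begin
        4 * F + 4 * M + S                                       ≡⟨ lhs ⟨
        ∑ˢ (λ I → 4 * loss I + 4 * avoidsLeaves I + pair I)     ≤⟨ sum-map-mono (loss-edge x y x∈L xy) (allSubsets s) ⟩
        ∑ˢ (λ I → 4 * 1 + 2 * totalCharge I)                    ≡⟨ rhs ⟩
        4 * S + 2 * ∑ˢ totalCharge                              ∎
      regroup : ∀ S M K m → 4 * S + 2 * (M * (K + m)) ≡ 4 * S + 2 * (M * K) + 2 * (M * m)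
      regroup = solve-∀
      regroup₂ : ∀ S t → 4 * S + 2 * S + 2 * t ≡ 5 * S + 2 * t + S
      regroup₂ = solve-∀

-- Passage to the integers

open Counting using (leaves; nonleaves; numDegOne≡leaves; leaves+nonleaves; 4fl-bound)
open import Data.Nat using (ℕ; _∸_)
import Data.Nat as Nat
open import Data.Integer using (ℤ; +_; _+_; _-_; _*_; _≤_; _^_; +≤+)
open import Data.Integer.Properties using (pos-+; pos-*; +-monoˡ-≤; module ≤-Reasoning)
open import Data.Integer.Tactic.RingSolver using (solve-∀)
open import Data.Nat.Properties using (m+n∸m≡n; +-comm)
open import Relation.Binary.PropositionalEquality using (_≡_; refl; sym; trans; cong; cong₂)

pos-^ : ∀ m n → + (m Nat.^ n) ≡ (+ m) ^ n
pos-^ m ℕ.zero    = refl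
pos-^ m (ℕ.suc n) = trans (pos-* m _) (cong (+ m *_) (pos-^ m n))

-- The factor `+ m - + 2` is negative for m < 2, so the term 4M can return to the right side only
-- over the integers.
bound-in-ℤ : ∀ F S m M → 4 Nat.* F Nat.+ 4 Nat.* M Nat.≤ 5 Nat.* S Nat.+ 2 Nat.* (M Nat.* m) →
             + 4 * + F ≤ + 5 * + S + (+ m - + 2) * (+ 2 * + M)
bound-in-ℤ F S m M le = begin
  + 4 * + F                                                  ≡⟨ add-sub (+ F) (+ M) ⟩
  (+ 4 * + F + + 4 * + M) - + 4 * + M                        ≡⟨ cong (_- + 4 * + M) lhs ⟨
  + (4 Nat.* F Nat.+ 4 Nat.* M) - + 4 * + M   ≤⟨ +-monoˡ-≤ (Data.Integer.- (+ 4 * + M)) (+≤+ le) ⟩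
  + (5 Nat.* S Nat.+ 2 Nat.* (M Nat.* m)) - + 4 * + M ≡⟨ cong (_- + 4 * + M) rhs ⟩
  (+ 5 * + S + + 2 * (+ M * + m)) - + 4 * + M                ≡⟨ collect (+ S) (+ M) (+ m) ⟩
  + 5 * + S + (+ m - + 2) * (+ 2 * + M)                      ∎
  where
  open ≤-Reasoning
  lhs : + (4 Nat.* F Nat.+ 4 Nat.* M) ≡ + 4 * + F + + 4 * + M
  lhs = trans (pos-+ (4 Nat.* F) _) (cong₂ _+_ (pos-* 4 F) (pos-* 4 M))
  rhs : + (5 Nat.* S Nat.+ 2 Nat.* (M Nat.* m)) ≡ + 5 * + S + + 2 * (+ M * + m)
  rhs = trans (pos-+ (5 Nat.* S) _) (cong₂ _+_ (pos-* 5 S) (trans (pos-* 2 (M Nat.* m)) (cong (+ 2 *_) (pos-* M m))))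
  add-sub : ∀ F M → + 4 * F ≡ (+ 4 * F + + 4 * M) - + 4 * M
  add-sub = solve-∀
  collect : ∀ S M m → (+ 5 * S + + 2 * (M * m)) - + 4 * M ≡ + 5 * S + (m - + 2) * (+ 2 * M)
  collect = solve-∀

-- Both sides are multiplied by 4, which turns the exponents s - 2 and s - ℓ - 1 into s and s - ℓ +
-- 1, never negative.
theorem4p4 : (s ℓ : ℕ) (R : Graph s) → numDegOne R ≡ ℓ →
    + 4 * + fl R ≤ + 5 * (+ 2) ^ s + ((+ s - + ℓ) - + 2) * (+ 2) ^ (s ∸ ℓ Data.Nat.+ 1)
theorem4p4 s ℓ R refl = begin
  + 4 * + fl R                                                              ≤⟨ bound-in-ℤ (fl R) (2 Nat.^ s) m (2 Nat.^ m) (4fl-bound R) ⟩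
  + 5 * + (2 Nat.^ s) + (+ m - + 2) * (+ 2 * + (2 Nat.^ m))       ≡⟨ cong₂ (λ S M → + 5 * S + (+ m - + 2) * (+ 2 * M)) (pos-^ 2 s) (pos-^ 2 m) ⟩
  + 5 * (+ 2) ^ s + (+ m - + 2) * (+ 2) ^ ℕ.suc m                           ≡⟨ cong₂ (λ i e → + 5 * (+ 2) ^ s + (i - + 2) * (+ 2) ^ e) s-ℓ≡m exponent ⟨
  + 5 * (+ 2) ^ s + ((+ s - + ℓ) - + 2) * (+ 2) ^ (s ∸ ℓ Data.Nat.+ 1)      ∎
  where
  open ≤-Reasoning
  m : ℕ
  m = nonleaves R
  s≡ : s ≡ ℓ Nat.+ m
  s≡ = trans (sym (leaves+nonleaves R)) (cong (Nat._+ m) (sym (numDegOne≡leaves R)))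
  -- The subtraction does not truncate, because `s≡` exhibits `s` as `ℓ` plus `m`.
  exponent : s ∸ ℓ Nat.+ 1 ≡ ℕ.suc m
  exponent = trans (+-comm (s ∸ ℓ) 1) (cong ℕ.suc (trans (cong (_∸ ℓ) s≡) (m+n∸m≡n ℓ m)))
  cancel : ∀ l m → (l + m) - l ≡ m
  cancel = solve-∀
  s-ℓ≡m : + s - + ℓ ≡ + m
  s-ℓ≡m = trans (cong (λ n → + n - + ℓ) s≡) (trans (cong (_- + ℓ) (pos-+ ℓ m)) (cancel (+ ℓ) (+ m)))
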